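{- Let $G=(V,E)$ be a finite graph and let $\underline{r}^G=(r_v)_{v\in V}\in\mathbb{Z}^{V}$. Let $H$ be an arbitrary $2$-cover of $G$, and let $G\times K_2$ be the bipartite double cover of $G$. Let $\underline{r}$ denote the vector induced by $\underline{r}^G$ on $H$ and on $G\times K_2$, i.e. each lift $u'$ of a vertex $u\in V$ gets value $r_{u'}=r_u$. Then $$h_{\underline{r}}(G\times K_2)\geq h_{\underline{r}}(H).$$ In other words, for any $\underline{r}\in\mathbb{Z}^{V}$, among all $2$-covers $H$ of $G$ the quantity $h_{\underline{r}}(H)$ is maximized by $G\times K_2$.
   Context: A $2$-cover of $G$ is a graph with vertex set $V\times\{0,1\}$ obtained by choosing, for every edge $uv\in E$, either the pair of edges $(u,0)(v,0),(u,1)(v,1)$ or the pair $(u,0)(v,1),(u,1)(v,0)$, and having no other edges. The bipartite double cover $G\times K_2$ is the $2$-cover in which the second choice is made for every edge. For a graph $F$ and $\underline{r}=(r_v)\in\mathbb{Z}^{V(F)}$, $h_{\underline{r}}(F)$ denotes the number of subgraphs (edge subsets) $S$ of $F$ such that every vertex $v$ is incident to exactly $r_v$ edges of $S$. -}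

module Defs where

open import Data.Fin using (Fin)
import Data.Fin.Properties as Fin
open import Data.Integer using (ℤ; +_)
import Data.Integer.Properties as ℤ
open import Data.List using (List; []; _∷_; _++_; map; filter; length; allFin)
open import Data.Nat using (ℕ; _*_)
open import Data.Product using (_×_; _,_; proj₁; proj₂)
open import Data.Product.Function.NonDependent.Propositional using (_×-↔_)
open import Data.Sum using (_⊎_)
open import Function using (_∘_)
open import Function.Bundles using (_↔_; Inverse)
open import Function.Construct.Composition using (_↔-∘_)
open import Function.Construct.Identity using (↔-id)
open import Function.Construct.Symmetry using (↔-sym)
open import Function.Properties.Inverse using (↔⇒↣)
open import Level using (0ℓ)
open import Relation.Binary.Core using (Rel)
open import Relation.Binary.Definitions using (Decidable; DecidableEquality; Symmetric; Irreflexive)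
open import Relation.Binary.PropositionalEquality using (_≡_; _≢_; refl; sym; subst)
open import Relation.Nullary.Decidable using (Dec; map′; ¬?; _×-dec_; _⊎-dec_)
import Relation.Unary as U

record FiniteGraph : Set₁ where
  infix 4 _~_ _~?_ _≟_
  field
    V        : Set
    order    : ℕ
    finite   : V ↔ Fin order
    _~_      : Rel V 0ℓ
    _~?_     : Decidable _~_
    ~-sym    : Symmetric _~_
    ~-irrefl : Irreflexive _≡_ _~_

  _≟_ : DecidableEquality V
  _≟_ = Fin.inj⇒≟ (↔⇒↣ finite)

  all? : ∀ {P : V → Set} → U.Decidable P → Dec (∀ v → P v)
  all? {P} P? = map′
    (λ p v → subst P (strictlyInverseʳ v) (p (to v)))
    (λ p i → p (from i))
    (Fin.all? (λ i → P? (from i)))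
    where open Inverse finite

  vertices : List V
  vertices = map (Inverse.from finite) (allFin order)

-- The pairs of entries at two different positions, each pair of positions once:
-- for a duplicate-free list, its 2-element subsets.
unorderedPairs : ∀ {A : Set} → List A → List (A × A)
unorderedPairs []       = []
unorderedPairs (x ∷ xs) = map (x ,_) xs ++ unorderedPairs xs

-- The sublists, one for each set of positions: for a duplicate-free list,
-- its subsets.
subsets : ∀ {A : Set} → List A → List (List A)
subsets []       = [] ∷ []
subsets (x ∷ xs) = map (x ∷_) (subsets xs) ++ subsets xs

module _ (F : FiniteGraph) where
  open FiniteGraph F

  -- Every edge is listed once, with one of its two orientations.
  edges : List (V × V)
  edges = filter (λ e → proj₁ e ~? proj₂ e) (unorderedPairs vertices)

  Incident : V → V × V → Set
  Incident v (x , y) = v ≡ x ⊎ v ≡ y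

  incident? : ∀ v → U.Decidable (Incident v)
  incident? v (x , y) = (v ≟ x) ⊎-dec (v ≟ y)

  degree : List (V × V) → V → ℕ
  degree S v = length (filter (incident? v) S)

  HasDegrees : (V → ℤ) → List (V × V) → Set
  HasDegrees r S = ∀ v → + degree S v ≡ r v

  hasDegrees? : ∀ r → U.Decidable (HasDegrees r)
  hasDegrees? r S = all? (λ v → + degree S v ℤ.≟ r v)

  h : (V → ℤ) → ℕ
  h r = length (filter (hasDegrees? r) (subsets edges))

-- The two ways to lift an edge uv: to (u,0)(v,0), (u,1)(v,1) or to
-- (u,0)(v,1), (u,1)(v,0).
data Lift : Set where
  parallel crossed : Lift

Joins : Lift → Rel (Fin 2) 0ℓ
Joins parallel i j = i ≡ j
Joins crossed  i j = i ≢ j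

joins? : ∀ l → Decidable (Joins l)
joins? parallel i j = i Fin.≟ j
joins? crossed  i j = ¬? (i Fin.≟ j)

joins-sym : ∀ l → Symmetric (Joins l)
joins-sym parallel i≡j = sym i≡j
joins-sym crossed  i≢j = i≢j ∘ sym

-- One lift for every edge uv; the values at non-adjacent pairs are not used.
record EdgeLifts (G : FiniteGraph) : Set where
  open FiniteGraph G
  field
    lift     : V → V → Lift
    lift-sym : ∀ {u v} → u ~ v → lift u v ≡ lift v u

twoCover : (G : FiniteGraph) → EdgeLifts G → FiniteGraph
twoCover G σ = record
  { V        = V × Fin 2
  ; order    = order * 2
  ; finite   = ↔-sym Fin.*↔× ↔-∘ (finite ×-↔ ↔-id (Fin 2))
  ; _~_      = λ (u , i) (v , j) → u ~ v × Joins (lift u v) i j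
  ; _~?_     = λ (u , i) (v , j) → (u ~? v) ×-dec joins? (lift u v) i j
  ; ~-sym    = λ { {u , i} {v , j} (u~v , q) →
                 ~-sym u~v , subst (λ l → Joins l j i) (lift-sym u~v) (joins-sym (lift u v) q) }
  ; ~-irrefl = λ { refl (u~u , _) → ~-irrefl refl u~u }
  }
  where
  open FiniteGraph G
  open EdgeLifts σ

allCrossed : (G : FiniteGraph) → EdgeLifts G
allCrossed G = record { lift = λ _ _ → crossed ; lift-sym = λ _ → refl }

_×K₂ : FiniteGraph → FiniteGraph
G ×K₂ = twoCover G (allCrossed G)

-- The vector induced on the vertex set V × {0,1} of any 2-cover.
induced : ∀ {A : Set} → (A → ℤ) → (A × Fin 2 → ℤ)
induced r (u , _) = r u

{-# OPTIONS --safe #-}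

-- Group the subgraphs of a 2-cover by the edges of G of which they contain both
-- lifts, one lift or none.  Edges with both lifts or none contribute the same in
-- every cover, so it suffices to compare, for every set M of edges of G, the
-- numbers of ways to choose one lift of each edge of M so that both lifts of
-- every vertex get the same degree.  For G × K₂ these are the Eulerian
-- orientations of M.  Fix an end at u of an edge of M.  In a balanced choice,
-- exactly deg u / 2 of the ends at u lie on the other lift of u.  Joining the
-- fixed end to such an end removes two ends at u and leaves a balanced choice on
-- a multigraph with one edge fewer, in which two crossed edges are joined to a
-- crossed edge.  Summing over all ends at u expresses deg u / 2 times the count
-- for M as a sum of counts for smaller multigraphs, and induction applies.  A
-- loop can be joined to itself only if it is crossed.
module Submission where

open import Defs
open import Data.Fin using (Fin; zero; suc; remQuot)
open import Data.Fin.Patterns using (0F; 1F)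
open import Data.Integer using (ℤ) renaming (+_ to pos)
import Data.Integer.Properties as ℤ
open import Data.List using (List; []; _∷_; _++_; allFin; concat; concatMap; filter; length; map; replicate; tabulate)
open import Data.List.Properties using (++-assoc; concatMap-++; concatMap-map; filter-++; filter-accept; filter-reject; map-++; map-cong-local; map-replicate; map-tabulate; map-∘)
open import Data.List.Relation.Binary.Permutation.Propositional using (_↭_; ↭-refl; ↭-reflexive; ↭-trans; prep; swap; module PermutationReasoning)
open import Data.List.Relation.Binary.Permutation.Propositional.Properties using (++-comm; ++⁺ʳ; shift) renaming (++⁺ to ↭-++⁺)
open import Data.List.Relation.Unary.All as All using (All; []; _∷_)
open import Data.List.Relation.Unary.All.Properties using (++⁺; all-filter; map⁺; replicate⁺)
open import Data.Nat using (ℕ; zero; suc; _+_; _*_; _≤_; _≥_; z≤n; NonZero)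
open import Data.Nat.ListAction using (sum)
open import Data.Nat.ListAction.Properties using (sum-++)
open import Data.Nat.Properties renaming (_≟_ to _≟ℕ_)
open import Algebra.Properties.CommutativeSemigroup +-commutativeSemigroup using (interchange; x∙yz≈y∙xz)
open import Data.Nat.Tactic.RingSolver using (solve-∀)
open import Data.Product using (_×_; _,_; proj₁; proj₂)
open import Function using (_∘_)
open import Function.Bundles using (Inverse)
open import Relation.Binary.Definitions using (DecidableEquality)
open import Relation.Binary.PropositionalEquality
open import Relation.Nullary using (Dec; yes; no; ¬_; contradiction)
open import Relation.Nullary.Decidable using (_⊎-dec_)
open import Relation.Unary using (Decidable)

-- Indicators, filters and subsets

indicator : {P : Set} → Dec P → ℕ
indicator (yes _) = 1
indicator (no _)  = 0

indicator-cong : {P Q : Set} → (P → Q) → (Q → P) → (P? : Dec P) (Q? : Dec Q) → indicator P? ≡ indicator Q?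
indicator-cong f g (yes p) (yes q) = refl
indicator-cong f g (yes p) (no ¬q) = contradiction (f p) ¬q
indicator-cong f g (no ¬p) (yes q) = contradiction (g q) ¬p
indicator-cong f g (no ¬p) (no ¬q) = refl

indicator-no : {P : Set} → ¬ P → (P? : Dec P) → indicator P? ≡ 0
indicator-no ¬p (yes p) = contradiction p ¬p
indicator-no ¬p (no _)  = refl

indicator-true : {P : Set} (P? : Dec P) → indicator P? ≢ 0 → P
indicator-true (yes p) _  = p
indicator-true (no _)  ≢0 = contradiction refl ≢0

indicator-⊎ : {P Q : Set} → ¬ (P × Q) → (P? : Dec P) (Q? : Dec Q) →
  indicator (P? ⊎-dec Q?) ≡ indicator P? + indicator Q?
indicator-⊎ disj (yes p) (yes q) = contradiction (p , q) disj
indicator-⊎ disj (yes p) (no ¬q) = refl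
indicator-⊎ disj (no ¬p) (yes q) = refl
indicator-⊎ disj (no ¬p) (no ¬q) = refl

length-filter-∷ : {A : Set} {P : A → Set} (P? : Decidable P) → ∀ x xs →
  length (filter P? (x ∷ xs)) ≡ indicator (P? x) + length (filter P? xs)
length-filter-∷ P? x xs with P? x
... | yes _ = refl
... | no _  = refl

length-filter : {A : Set} {P : A → Set} (P? : Decidable P) → ∀ xs →
  length (filter P? xs) ≡ sum (map (indicator ∘ P?) xs)
length-filter P? []       = refl
length-filter P? (x ∷ xs) = trans (length-filter-∷ P? x xs) (cong (indicator (P? x) +_) (length-filter P? xs))

All-subsets : {A : Set} {P : A → Set} {xs : List A} → All P xs → All (All P) (subsets xs)
All-subsets []       = [] ∷ []
All-subsets (p ∷ ps) = ++⁺ (map⁺ (All.map (p ∷_) (All-subsets ps))) (All-subsets ps)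

-- Sums over two lifts, and lift types as elements of the group of order two

flip : Fin 2 → Fin 2
flip 0F = 1F
flip 1F = 0F

-- Opaque, so that the summand can be inferred from a sum.
opaque
  ∑₂ : (Fin 2 → ℕ) → ℕ
  ∑₂ f = f 0F + f 1F

  ∑₂-def : ∀ f → ∑₂ f ≡ f 0F + f 1F
  ∑₂-def f = refl

  ∑₂-cong : ∀ {f g} → (∀ s → f s ≡ g s) → ∑₂ f ≡ ∑₂ g
  ∑₂-cong eq = cong₂ _+_ (eq 0F) (eq 1F)

  ∑₂-mono : ∀ {f g} → (∀ s → f s ≤ g s) → ∑₂ f ≤ ∑₂ g
  ∑₂-mono le = +-mono-≤ (le 0F) (le 1F)

  ∑₂-+ : ∀ f g → ∑₂ (λ s → f s + g s) ≡ ∑₂ f + ∑₂ g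
  ∑₂-+ f g = interchange (f 0F) (g 0F) (f 1F) (g 1F)

  ∑₂-* : ∀ c f → ∑₂ (λ s → c * f s) ≡ c * ∑₂ f
  ∑₂-* c f = sym (*-distribˡ-+ c (f 0F) (f 1F))

  ∑₂-comm : ∀ (f : Fin 2 → Fin 2 → ℕ) → ∑₂ (λ s → ∑₂ (f s)) ≡ ∑₂ (λ s′ → ∑₂ (λ s → f s s′))
  ∑₂-comm f = interchange (f 0F 0F) (f 0F 1F) (f 1F 0F) (f 1F 1F)

  ∑₂-flip : ∀ f → ∑₂ (f ∘ flip) ≡ ∑₂ f
  ∑₂-flip f = +-comm (f 1F) (f 0F)

sum-map-replicate : ∀ {A : Set} (f : A → ℕ) n x → sum (map f (replicate n x)) ≡ n * f x
sum-map-replicate f zero    x = refl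
sum-map-replicate f (suc n) x = cong (f x +_) (sum-map-replicate f n x)

sum-map-mono : ∀ {A : Set} {f g : A → ℕ} {xs} → All (λ x → f x ≤ g x) xs →
  sum (map f xs) ≤ sum (map g xs)
sum-map-mono []       = z≤n
sum-map-mono (p ∷ ps) = +-mono-≤ p (sum-map-mono ps)

-- The lifts of an edge uv are the edges from (u , s) to (v , l · s).
_·_ : Lift → Fin 2 → Fin 2
parallel · s = s
crossed  · s = flip s

-- If uv and uw have lifts l and m, then joining (v , l · s) to (w , m · flip s)
-- for every s is a lift of vw.
_⊙_ : Lift → Lift → Lift
crossed  ⊙ m        = m
parallel ⊙ parallel = crossed
parallel ⊙ crossed  = parallel

-- With `parallel` as 0 and `crossed` as 1 modulo 2, `l ⊙ m` is l + m + 1. The extra 1 is the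
-- passage from one lift of u to the other.
⊙-· : ∀ l m s → (l ⊙ m) · (l · s) ≡ m · flip s
⊙-· parallel parallel 0F = refl
⊙-· parallel parallel 1F = refl
⊙-· parallel crossed  0F = refl
⊙-· parallel crossed  1F = refl
⊙-· crossed  parallel s  = refl
⊙-· crossed  crossed  s  = refl

·-involutive : ∀ l s → l · (l · s) ≡ s
·-involutive parallel s  = refl
·-involutive crossed  0F = refl
·-involutive crossed  1F = refl

joins-· : ∀ l s → Joins l s (l · s)
joins-· parallel s  = refl
joins-· crossed  0F = λ ()
joins-· crossed  1F = λ ()

¬joins-flip : ∀ l s → ¬ Joins l s (flip (l · s))
¬joins-flip parallel 0F ()
¬joins-flip parallel 1F ()
¬joins-flip crossed  0F 0≢0 = 0≢0 refl
¬joins-flip crossed  1F 1≢1 = 1≢1 refl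

∑₂-reindex : ∀ l f → ∑₂ (f ∘ (l ·_)) ≡ ∑₂ f
∑₂-reindex parallel f = refl
∑₂-reindex crossed  f = ∑₂-flip f

pair-swap : ∀ {A : Set} (w x y z : A) l → w ∷ x ∷ y ∷ z ∷ l ↭ y ∷ z ∷ w ∷ x ∷ l
pair-swap w x y z l = ++⁺ʳ l (++-comm (w ∷ x ∷ []) (y ∷ z ∷ []))

-- Choices of one lift per edge of a multigraph

module Configurations {A : Set} (_≟_ : DecidableEquality A) where

  Half : Set
  Half = A × Fin 2

  -- Lists of these are multigraphs: loops and repeated edges are allowed, because splicing creates
  -- them.
  Edge : Set
  Edge = A × A × Lift

  Weight : Set
  Weight = List Half → ℕ

  cross : Edge → Edge
  cross (u , v , _) = u , v , crossed

  -- The sum of W over all choices of one of the two lifts of every edge,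
  -- applied to the list of the endpoints of the chosen lifts.
  ⟦_⟧ : List Edge → Weight → ℕ
  ⟦ []              ⟧ W = W []
  ⟦ (u , v , t) ∷ M ⟧ W = ∑₂ λ s → ⟦ M ⟧ (λ l → W ((u , s) ∷ (v , t · s) ∷ l))

  δ : A → A → ℕ
  δ u a = indicator (u ≟ a)

  -- Defined by cases on both indices, so that it computes to 0 as soon as they are known to differ.
  hit : A → Fin 2 → Half → ℕ
  hit u 0F (a , 0F) = δ u a
  hit u 0F (a , 1F) = 0
  hit u 1F (a , 0F) = 0
  hit u 1F (a , 1F) = δ u a

  hit-≢ : ∀ {u a} → u ≢ a → ∀ i → hit u i (a , i) ≡ 0
  hit-≢ {u} {a} u≢a i with u ≟ a in eq
  hit-≢ u≢a i  | yes u≡a = contradiction u≡a u≢a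
  hit-≢ u≢a 0F | no _    = cong indicator eq
  hit-≢ u≢a 1F | no _    = cong indicator eq

  mult : A → Fin 2 → List Half → ℕ
  mult u i []      = 0
  mult u i (x ∷ l) = hit u i x + mult u i l

  deg : A → List Edge → ℕ
  deg w []                = 0
  deg w ((a , b , _) ∷ M) = δ w a + (δ w b + deg w M)

  Invariant : Weight → Set
  Invariant W = ∀ {l l′} → l ↭ l′ → W l ≡ W l′

  -- The class of weights on which the induction runs. It contains the indicator of prescribed
  -- degrees and is closed under `cancel`.
  record BalancedWeight (W : Weight) : Set where
    field
      invariant : Invariant W
      balanced  : ∀ l → W l ≢ 0 → ∀ u → mult u 0F l ≡ mult u 1F l

  -- Two ends on opposite lifts of `u` leave the multigraph but are still seen by the weight.
  cancel : A → Weight → Weight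
  cancel u W l = W ((u , 0F) ∷ (u , 1F) ∷ l)

  flip-pair : ∀ u s {l : List Half} → (u , s) ∷ (u , flip s) ∷ l ↭ (u , 0F) ∷ (u , 1F) ∷ l
  flip-pair u 0F = ↭-refl
  flip-pair u 1F = swap _ _ ↭-refl

  cancel-balanced : ∀ {W} u → BalancedWeight W → BalancedWeight (cancel u W)
  cancel-balanced u g = record
    { invariant = λ p → invariant (prep _ (prep _ p))
    ; balanced  = λ l ≢0 w → +-cancelˡ-≡ (δ w u) _ _ (balanced _ ≢0 w)
    }
    where open BalancedWeight g

  prepend-invariant : ∀ {W} x y → Invariant W → Invariant (λ l → W (x ∷ y ∷ l))
  prepend-invariant x y inv p = inv (prep x (prep y p))

  total-∷ : ∀ w a s l → mult w 0F ((a , s) ∷ l) + mult w 1F ((a , s) ∷ l) ≡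
    δ w a + (mult w 0F l + mult w 1F l)
  total-∷ w a 0F l = +-assoc (δ w a) _ _
  total-∷ w a 1F l = x∙yz≈y∙xz (mult w 0F l) (δ w a) (mult w 1F l)

  -- Whatever lifts are chosen, `deg u M` ends lie over `u`, so the weights are evaluated only at
  -- lists with these totals.
  ⟦⟧-cong-deg : ∀ M {W W′} →
    (∀ l → (∀ u → mult u 0F l + mult u 1F l ≡ deg u M) → W l ≡ W′ l) →
    ⟦ M ⟧ W ≡ ⟦ M ⟧ W′
  ⟦⟧-cong-deg []                eq = eq [] (λ _ → refl)
  ⟦⟧-cong-deg ((a , b , t) ∷ M) eq = ∑₂-cong λ s → ⟦⟧-cong-deg M λ l total →
    eq _ λ u → trans (total-∷ u a s ((b , t · s) ∷ l)) (cong (δ u a +_)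
      (trans (total-∷ u b (t · s) l) (cong (δ u b +_) (total u))))

  ⟦⟧-cong : ∀ M {W W′} → (∀ l → W l ≡ W′ l) → ⟦ M ⟧ W ≡ ⟦ M ⟧ W′
  ⟦⟧-cong M eq = ⟦⟧-cong-deg M λ l _ → eq l

  ⟦⟧-+ : ∀ M W W′ → ⟦ M ⟧ (λ l → W l + W′ l) ≡ ⟦ M ⟧ W + ⟦ M ⟧ W′
  ⟦⟧-+ []                W W′ = refl
  ⟦⟧-+ ((a , b , t) ∷ M) W W′ = trans (∑₂-cong λ s → ⟦⟧-+ M _ _) (∑₂-+ (λ s → ⟦ M ⟧ _) (λ s → ⟦ M ⟧ _))

  ⟦⟧-* : ∀ M c W → ⟦ M ⟧ (λ l → c * W l) ≡ c * ⟦ M ⟧ W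
  ⟦⟧-* []                c W = refl
  ⟦⟧-* ((a , b , t) ∷ M) c W = trans (∑₂-cong λ s → ⟦⟧-* M c _) (∑₂-* c (λ s → ⟦ M ⟧ _))

  -- Splicing two ends at a vertex

  -- The edge lists obtained from (u , v , t) ∷ M by joining its end u to an end
  -- at u of an edge of M.
  splices : A → A → Lift → List Edge → List (List Edge)
  splices u v t []                 = []
  splices u v t ((a , b , t′) ∷ M) =
    replicate (δ u a) ((v , b , t ⊙ t′) ∷ M) ++
    replicate (δ u b) ((v , a , t ⊙ t′) ∷ M) ++
    map ((a , b , t′) ∷_) (splices u v t M)

  splices-length : ∀ u v t M → All (λ N → length N ≡ length M) (splices u v t M)
  splices-length u v t []                 = []
  splices-length u v t ((a , b , t′) ∷ M) =
    ++⁺ (replicate⁺ (δ u a) refl) (++⁺ (replicate⁺ (δ u b) refl)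
      (map⁺ (All.map (cong suc) (splices-length u v t M))))

  -- The multiplicities of the splices depend on the vertices alone, and `crossed ⊙ crossed` is
  -- `crossed`: fully crossed multigraphs are closed under splicing.
  splices-cross : ∀ u v t M → splices u v crossed (map cross M) ≡ map (map cross) (splices u v t M)
  splices-cross u v t []                 = refl
  splices-cross u v t ((a , b , t′) ∷ M) = sym (begin
    map (map cross) (replicate (δ u a) x ++ replicate (δ u b) y ++ map (e ∷_) (splices u v t M))
      ≡⟨ map-++ (map cross) (replicate (δ u a) x) _ ⟩
    map (map cross) (replicate (δ u a) x) ++ map (map cross) (replicate (δ u b) y ++ map (e ∷_) (splices u v t M))
      ≡⟨ cong₂ _++_ (map-replicate (map cross) (δ u a) x) (map-++ (map cross) (replicate (δ u b) y) _) ⟩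
    replicate (δ u a) _ ++ map (map cross) (replicate (δ u b) y) ++ map (map cross) (map (e ∷_) (splices u v t M))
      ≡⟨ cong (replicate (δ u a) _ ++_) (cong₂ _++_ (map-replicate (map cross) (δ u b) y) tail) ⟩
    replicate (δ u a) _ ++ replicate (δ u b) _ ++ map (cross e ∷_) (splices u v crossed (map cross M)) ∎)
    where
    open ≡-Reasoning
    e = a , b , t′
    x = (v , b , t ⊙ t′) ∷ M
    y = (v , a , t ⊙ t′) ∷ M
    tail : map (map cross) (map (e ∷_) (splices u v t M)) ≡ map (cross e ∷_) (splices u v crossed (map cross M))
    tail = begin
      map (map cross) (map (e ∷_) (splices u v t M))       ≡⟨ map-∘ (splices u v t M) ⟨
      map (λ N → cross e ∷ map cross N) (splices u v t M)  ≡⟨ map-∘ (splices u v t M) ⟩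
      map (cross e ∷_) (map (map cross) (splices u v t M)) ≡⟨ cong (map (cross e ∷_)) (splices-cross u v t M) ⟨
      map (cross e ∷_) (splices u v crossed (map cross M)) ∎

  -- Of the four terms only the two with `s′` equal to `flip s` survive.
  ∑∑-hit : ∀ u a (g : Fin 2 → Fin 2 → ℕ) →
    ∑₂ (λ s → ∑₂ λ s′ → hit u (flip s) (a , s′) * g s s′) ≡ δ u a * ∑₂ (λ s → g s (flip s))
  ∑∑-hit u a g = trans
    (trans (∑₂-def _) (cong₂ _+_ (∑₂-def _) (∑₂-def _)))
    (trans (lemma (δ u a) (g 0F 1F) (g 1F 0F)) (cong (δ u a *_) (sym (∑₂-def _))))
    where
    lemma : ∀ d x y → (0 + d * x) + (d * y + 0) ≡ d * (x + y)
    lemma = solve-∀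

  -- If `a` is `u` and its end lies opposite to `(u , s)`, these two ends form a cancelled pair, and
  -- the ends at `v` and `b` form a lift of the joined edge.
  splice-end : ∀ {W} u v t a b t′ M → Invariant W →
    ∑₂ (λ s → ∑₂ λ s′ → hit u (flip s) (a , s′) *
      ⟦ M ⟧ (λ l → W ((u , s) ∷ (v , t · s) ∷ (a , s′) ∷ (b , t′ · s′) ∷ l)))
    ≡ δ u a * ⟦ (v , b , t ⊙ t′) ∷ M ⟧ (cancel u W)
  splice-end {W} u v t a b t′ M inv = trans (∑∑-hit u a _) ends
    where
    g : Fin 2 → ℕ
    g s = ⟦ M ⟧ (λ l → cancel u W ((v , s) ∷ (b , (t ⊙ t′) · s) ∷ l))
    ends : δ u a * ∑₂ (λ s → ⟦ M ⟧ (λ l → W ((u , s) ∷ (v , t · s) ∷ (a , flip s) ∷ (b , t′ · flip s) ∷ l)))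
      ≡ δ u a * ∑₂ g
    ends with u ≟ a
    ... | no _     = refl
    ... | yes refl = cong (1 *_) (trans
      (∑₂-cong λ s → ⟦⟧-cong M λ l → trans
        (inv (↭-trans (prep _ (swap _ _ ↭-refl)) (flip-pair u s)))
        (cong (λ i → cancel u W ((v , t · s) ∷ (b , i) ∷ l)) (sym (⊙-· t t′ s))))
      -- The joined edge is indexed by the lift of its end `v`, which is `t · s`.
      (∑₂-reindex t g))

  -- The factor `mult` counts the ends to which `(u , s)` can be joined. Induction on `M` splits
  -- this count into the two ends of the head edge and the ends of the remaining edges.
  splice-sum : ∀ {W} u v t M → Invariant W →
    ∑₂ (λ s → ⟦ M ⟧ (λ l → mult u (flip s) l * W ((u , s) ∷ (v , t · s) ∷ l)))
    ≡ sum (map (λ N → ⟦ N ⟧ (cancel u W)) (splices u v t M))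
  splice-sum u v t [] inv = ∑₂-* 0 (λ _ → 0)
  splice-sum {W} u v t (e@(a , b , t′) ∷ M) inv = begin
    ∑₂ (λ s → ∑₂ λ s′ → ⟦ M ⟧ (λ l → (hit u (flip s) (a , s′) + (hit u (flip s) (b , t′ · s′) + mult u (flip s) l)) * w s s′ l))
      ≡⟨ (∑₂-cong λ s → ∑₂-cong λ s′ → expand s s′) ⟩
    ∑₂ (λ s → ∑₂ λ s′ → P s s′ + (Q s s′ + R s s′))
      ≡⟨ (∑₂-cong λ s → trans (∑₂-+ (P s) _) (cong (∑₂ (P s) +_) (∑₂-+ (Q s) (R s)))) ⟩
    ∑₂ (λ s → ∑₂ (P s) + (∑₂ (Q s) + ∑₂ (R s)))
      ≡⟨ trans (∑₂-+ (λ s → ∑₂ (P s)) _) (cong (∑₂ (λ s → ∑₂ (P s)) +_) (∑₂-+ (λ s → ∑₂ (Q s)) (λ s → ∑₂ (R s)))) ⟩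
    ∑₂ (λ s → ∑₂ (P s)) + (∑₂ (λ s → ∑₂ (Q s)) + ∑₂ (λ s → ∑₂ (R s)))
      ≡⟨ cong₂ _+_ (splice-end u v t a b t′ M inv) (cong₂ _+_ secondEnd rest) ⟩
    δ u a * F X + (δ u b * F Y + sum (map F (map (e ∷_) Ns)))
      ≡⟨ cong₂ _+_ (sum-map-replicate F (δ u a) X) (cong (_+ sum (map F (map (e ∷_) Ns))) (sum-map-replicate F (δ u b) Y)) ⟨
    sum (map F (replicate (δ u a) X)) + (sum (map F (replicate (δ u b) Y)) + sum (map F (map (e ∷_) Ns)))
      ≡⟨ cong (sum (map F (replicate (δ u a) X)) +_) (sum-map-++ (replicate (δ u b) Y) _) ⟨
    sum (map F (replicate (δ u a) X)) + sum (map F (replicate (δ u b) Y ++ map (e ∷_) Ns))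
      ≡⟨ sum-map-++ (replicate (δ u a) X) _ ⟨
    sum (map F (replicate (δ u a) X ++ replicate (δ u b) Y ++ map (e ∷_) Ns)) ∎
    where
    open ≡-Reasoning
    F : List Edge → ℕ
    F N = ⟦ N ⟧ (cancel u W)
    X = (v , b , t ⊙ t′) ∷ M
    Y = (v , a , t ⊙ t′) ∷ M
    Ns = splices u v t M
    w : Fin 2 → Fin 2 → Weight
    w s s′ l = W ((u , s) ∷ (v , t · s) ∷ (a , s′) ∷ (b , t′ · s′) ∷ l)
    P Q R : Fin 2 → Fin 2 → ℕ
    P s s′ = hit u (flip s) (a , s′) * ⟦ M ⟧ (w s s′)
    Q s s′ = hit u (flip s) (b , t′ · s′) * ⟦ M ⟧ (w s s′)
    R s s′ = ⟦ M ⟧ (λ l → mult u (flip s) l * w s s′ l)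

    sum-map-++ : ∀ xs ys → sum (map F (xs ++ ys)) ≡ sum (map F xs) + sum (map F ys)
    sum-map-++ xs ys = trans (cong sum (map-++ F xs ys)) (sum-++ (map F xs) (map F ys))

    distrib : ∀ p q r x → (p + (q + r)) * x ≡ p * x + (q * x + r * x)
    distrib = solve-∀

    expand : ∀ s s′ → ⟦ M ⟧ (λ l → (hit u (flip s) (a , s′) + (hit u (flip s) (b , t′ · s′) + mult u (flip s) l)) * w s s′ l)
      ≡ P s s′ + (Q s s′ + R s s′)
    expand s s′ = trans (⟦⟧-cong M λ l → distrib (hit u (flip s) (a , s′)) (hit u (flip s) (b , t′ · s′)) (mult u (flip s) l) (w s s′ l))
      (trans (⟦⟧-+ M _ _) (cong₂ _+_ (⟦⟧-* M (hit u (flip s) (a , s′)) (w s s′)) (trans (⟦⟧-+ M _ _) (cong (_+ R s s′) (⟦⟧-* M (hit u (flip s) (b , t′ · s′)) (w s s′))))))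

    -- Reversing the head edge, that is, indexing its lifts by the end at `b`, reduces this to the
    -- case of a first end.
    secondEnd : ∑₂ (λ s → ∑₂ (Q s)) ≡ δ u b * F Y
    secondEnd = trans
      (∑₂-cong λ s → trans (sym (∑₂-reindex t′ (Q s))) (∑₂-cong λ s′ → cong₂ _*_
        (cong (λ i → hit u (flip s) (b , i)) (·-involutive t′ s′))
        (⟦⟧-cong M λ l → trans
          (cong (λ i → W ((u , s) ∷ (v , t · s) ∷ (a , t′ · s′) ∷ (b , i) ∷ l)) (·-involutive t′ s′))
          (inv (prep _ (prep _ (swap _ _ ↭-refl)))))))
      (splice-end u v t b a t′ M inv)

    reassemble : ∀ Ns → ∑₂ (λ s′ → sum (map (λ N → ⟦ N ⟧ (cancel u (λ l → W ((a , s′) ∷ (b , t′ · s′) ∷ l)))) Ns))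
      ≡ sum (map F (map (e ∷_) Ns))
    reassemble []       = ∑₂-* 0 (λ _ → 0)
    reassemble (N ∷ Ns) = trans (∑₂-+ (λ s′ → ⟦ N ⟧ _) _) (cong₂ _+_
      (∑₂-cong λ s′ → ⟦⟧-cong N λ l → inv (pair-swap _ _ _ _ l))
      (reassemble Ns))

    rest : ∑₂ (λ s → ∑₂ (R s)) ≡ sum (map F (map (e ∷_) Ns))
    rest = begin
      ∑₂ (λ s → ∑₂ (R s))
        -- With the lift of the head edge chosen outermost, its ends can be absorbed into the
        -- weight, and the induction hypothesis applies to `M`.
        ≡⟨ ∑₂-comm R ⟩
      ∑₂ (λ s′ → ∑₂ (λ s → R s s′))
        ≡⟨ (∑₂-cong λ s′ → ∑₂-cong λ s → ⟦⟧-cong M λ l → cong (mult u (flip s) l *_) (inv (pair-swap _ _ _ _ l))) ⟩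
      ∑₂ (λ s′ → ∑₂ (λ s → ⟦ M ⟧ (λ l → mult u (flip s) l * W ((a , s′) ∷ (b , t′ · s′) ∷ (u , s) ∷ (v , t · s) ∷ l))))
        ≡⟨ (∑₂-cong λ s′ → splice-sum u v t M (prepend-invariant _ _ inv)) ⟩
      ∑₂ (λ s′ → sum (map (λ N → ⟦ N ⟧ (cancel u (λ l → W ((a , s′) ∷ (b , t′ · s′) ∷ l)))) Ns))
        ≡⟨ reassemble Ns ⟩
      sum (map F (map (e ∷_) Ns)) ∎

  -- The contribution of joining the end at `u` to the other end of the same edge. It vanishes
  -- unless that edge is a crossed loop.
  loops : A → A → Lift → List Edge → Weight → ℕ
  loops u v t M W = ∑₂ λ s → hit u (flip s) (v , t · s) * ⟦ M ⟧ (λ l → W ((u , s) ∷ (v , t · s) ∷ l))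

  -- In a balanced configuration exactly half of the edge ends at u can be paired
  -- with the end u of the first edge.
  deg-expansion : ∀ {W} u v t M → BalancedWeight W →
    deg u ((u , v , t) ∷ M) * ⟦ (u , v , t) ∷ M ⟧ W
    ≡ 2 * (loops u v t M W + sum (map (λ N → ⟦ N ⟧ (cancel u W)) (splices u v t M)))
  deg-expansion {W} u v t M good = begin
    d * ⟦ (u , v , t) ∷ M ⟧ W
      ≡⟨ ∑₂-* d (λ s → ⟦ M ⟧ (w s)) ⟨
    ∑₂ (λ s → d * ⟦ M ⟧ (w s))
      ≡⟨ ∑₂-cong (λ s → sym (⟦⟧-* M d (w s))) ⟩
    ∑₂ (λ s → ⟦ M ⟧ (λ l → d * w s l))
      ≡⟨ (∑₂-cong λ s → ⟦⟧-cong-deg M λ l total → pairing s l total) ⟩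
    ∑₂ (λ s → ⟦ M ⟧ (λ l → 2 * (k s * w s l + mult u (flip s) l * w s l)))
      ≡⟨ (∑₂-cong λ s → trans (⟦⟧-* M 2 _) (cong (2 *_) (trans (⟦⟧-+ M _ _) (cong (_+ S s) (⟦⟧-* M (k s) (w s)))))) ⟩
    ∑₂ (λ s → 2 * (k s * ⟦ M ⟧ (w s) + S s))
      ≡⟨ ∑₂-* 2 _ ⟩
    2 * ∑₂ (λ s → k s * ⟦ M ⟧ (w s) + S s)
      ≡⟨ cong (2 *_) (∑₂-+ (λ s → k s * ⟦ M ⟧ (w s)) S) ⟩
    2 * (loops u v t M W + ∑₂ S)
      ≡⟨ cong (λ x → 2 * (loops u v t M W + x)) (splice-sum u v t M invariant) ⟩
    2 * (loops u v t M W + sum (map (λ N → ⟦ N ⟧ (cancel u W)) (splices u v t M))) ∎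
    where
    open ≡-Reasoning
    open BalancedWeight good
    d = deg u ((u , v , t) ∷ M)
    w : Fin 2 → Weight
    w s l = W ((u , s) ∷ (v , t · s) ∷ l)
    k S : Fin 2 → ℕ
    k s = hit u (flip s) (v , t · s)
    S s = ⟦ M ⟧ (λ l → mult u (flip s) l * w s l)

    half : ∀ x y → x + y ≡ d → x ≡ y → d ≡ 2 * x × d ≡ 2 * y
    half x .x eq refl = eq′ , eq′
      where eq′ = trans (sym eq) (cong (x +_) (sym (+-identityʳ x)))

    -- The fixed end `(u , s)` does not count on the opposite lift, so the multiplicity there, half
    -- of `d`, is `k s` plus that of `l`.
    double : ∀ s l → let l′ = (u , s) ∷ (v , t · s) ∷ l in
      mult u 0F l′ + mult u 1F l′ ≡ d → mult u 0F l′ ≡ mult u 1F l′ → d ≡ 2 * (k s + mult u (flip s) l)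
    double 0F l eq bal = proj₂ (half _ _ eq bal)
    double 1F l eq bal = proj₁ (half _ _ eq bal)

    pairing : ∀ s l → (∀ x → mult x 0F l + mult x 1F l ≡ deg x M) →
      d * w s l ≡ 2 * (k s * w s l + mult u (flip s) l * w s l)
    -- Balance is known only where the weight is nonzero; elsewhere both sides are 0.
    pairing s l total with w s l ≟ℕ 0
    ... | yes w≡0 = trans (cong (d *_) w≡0) (sym (trans (cong (λ x → 2 * (k s * x + mult u (flip s) l * x)) w≡0) zeros))
      where
      zero-lemma : ∀ p q r → 2 * (p * 0 + q * 0) ≡ r * 0
      zero-lemma = solve-∀
      zeros = zero-lemma (k s) (mult u (flip s) l) d
    ... | no w≢0 = trans
      (cong (_* w s l) (double s l
        (trans (total-∷ u u s ((v , t · s) ∷ l)) (cong (δ u u +_) (trans (total-∷ u v (t · s) l) (cong (δ u v +_) (total u)))))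
        (balanced _ w≢0 u)))
      (distrib (k s) (mult u (flip s) l) (w s l))
      where
      distrib : ∀ p q x → 2 * (p + q) * x ≡ 2 * (p * x + q * x)
      distrib = solve-∀

  -- Induction on the number of edges

  deg-cross : ∀ w M → deg w (map cross M) ≡ deg w M
  deg-cross w []                = refl
  deg-cross w ((a , b , t) ∷ M) = cong (λ x → δ w a + (δ w b + x)) (deg-cross w M)

  deg-head-nonZero : ∀ u v t M → NonZero (deg u ((u , v , t) ∷ M))
  deg-head-nonZero u v t M with u ≟ u
  ... | yes _  = _
  ... | no u≢u = contradiction refl u≢u

  -- Both counts are multiplied by the same positive degree, expanded and compared term by term. The
  -- recursion is on the length `n`, since splices are shorter than the edge list but not sublists
  -- of it.
  ⟦⟧-cross-max : ∀ n M {W} → length M ≡ n → BalancedWeight W → ⟦ M ⟧ W ≤ ⟦ map cross M ⟧ W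
  ⟦⟧-cross-max n       []                      len good = ≤-refl
  ⟦⟧-cross-max (suc n) (e@(u , v , t) ∷ M) {W} len good =
    *-cancelˡ-≤ (deg u (e ∷ M)) {{deg-head-nonZero u v t M}} (begin
      deg u (e ∷ M) * ⟦ e ∷ M ⟧ W
        ≡⟨ deg-expansion u v t M good ⟩
      2 * (loops u v t M W + sum (map F (splices u v t M)))
        ≤⟨ *-monoʳ-≤ 2 (+-mono-≤ loops-≤ splices-≤) ⟩
      2 * (loops u v crossed (map cross M) W + sum (map F (splices u v crossed (map cross M))))
        ≡⟨ deg-expansion u v crossed (map cross M) good ⟨
      deg u (map cross (e ∷ M)) * ⟦ map cross (e ∷ M) ⟧ W
        ≡⟨ cong (_* ⟦ map cross (e ∷ M) ⟧ W) (deg-cross u (e ∷ M)) ⟩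
      deg u (e ∷ M) * ⟦ map cross (e ∷ M) ⟧ W ∎)
    where
    open ≤-Reasoning
    open BalancedWeight good
    F : List Edge → ℕ
    F N = ⟦ N ⟧ (cancel u W)

    loop-≤ : ∀ t s → hit u (flip s) (v , t · s) * ⟦ M ⟧ (λ l → W ((u , s) ∷ (v , t · s) ∷ l))
      ≤ hit u (flip s) (v , flip s) * ⟦ map cross M ⟧ (λ l → W ((u , s) ∷ (v , flip s) ∷ l))
    -- Both ends of a parallel lift have the same index, so the left side computes to 0.
    loop-≤ parallel 0F = z≤n
    loop-≤ parallel 1F = z≤n
    -- The ends of a crossed loop cancel each other, which leaves `M` with one edge fewer.
    loop-≤ crossed  s  with u ≟ v
    ... | yes refl = *-monoʳ-≤ (hit u (flip s) (u , flip s)) (begin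
      ⟦ M ⟧ (λ l → W ((u , s) ∷ (u , flip s) ∷ l))
        ≡⟨ ⟦⟧-cong M (λ l → invariant (flip-pair u s)) ⟩
      ⟦ M ⟧ (cancel u W)
        ≤⟨ ⟦⟧-cross-max n M (suc-injective len) (cancel-balanced u good) ⟩
      ⟦ map cross M ⟧ (cancel u W)
        ≡⟨ ⟦⟧-cong (map cross M) (λ l → invariant (flip-pair u s)) ⟨
      ⟦ map cross M ⟧ (λ l → W ((u , s) ∷ (u , flip s) ∷ l)) ∎)
    ... | no u≢v = ≤-trans (≤-reflexive (cong (_* ⟦ M ⟧ _) (hit-≢ u≢v (flip s)))) z≤n

    loops-≤ : loops u v t M W ≤ loops u v crossed (map cross M) W
    loops-≤ = ∑₂-mono (loop-≤ t)

    splices-≤ : sum (map F (splices u v t M)) ≤ sum (map F (splices u v crossed (map cross M)))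
    splices-≤ = begin
      sum (map F (splices u v t M))
        ≤⟨ sum-map-mono (All.map (λ {N} len′ → ⟦⟧-cross-max n N (trans len′ (suc-injective len)) (cancel-balanced u good)) (splices-length u v t M)) ⟩
      sum (map (F ∘ map cross) (splices u v t M))
        ≡⟨ cong sum (map-∘ (splices u v t M)) ⟩
      sum (map F (map (map cross) (splices u v t M)))
        ≡⟨ cong (sum ∘ map F) (splices-cross u v t M) ⟨
      sum (map F (splices u v crossed (map cross M))) ∎

  -- Reduction to one lift per edge

  -- The sum of W over all sets of lifts of edges in L together with one lift of
  -- every edge in M: an edge of L contributes both lifts, none, or exactly one.
  ∑lifts : List Edge → List Edge → Weight → ℕ
  ∑lifts []                M W = ⟦ M ⟧ W
  ∑lifts ((u , v , t) ∷ L) M W =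
    ∑lifts L M (cancel u (cancel v W)) + ∑lifts L M W + ∑lifts L ((u , v , t) ∷ M) W

  -- Edges with both lifts or none enter only through their vertices, so the two sums match branch
  -- by branch.
  ∑lifts-cross-max : ∀ L M {W} → BalancedWeight W → ∑lifts L M W ≤ ∑lifts (map cross L) (map cross M) W
  ∑lifts-cross-max []                M good = ⟦⟧-cross-max (length M) M refl good
  ∑lifts-cross-max ((u , v , t) ∷ L) M good = +-mono-≤
    (+-mono-≤ (∑lifts-cross-max L M (cancel-balanced u (cancel-balanced v good))) (∑lifts-cross-max L M good))
    (∑lifts-cross-max L ((u , v , t) ∷ M) good)

  ∑lifts-cong : ∀ L M {W W′} → (∀ l → W l ≡ W′ l) → ∑lifts L M W ≡ ∑lifts L M W′
  ∑lifts-cong []      M eq = ⟦⟧-cong M eq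
  ∑lifts-cong (e ∷ L) M eq = cong₂ _+_
    (cong₂ _+_ (∑lifts-cong L M (λ l → eq _)) (∑lifts-cong L M eq))
    (∑lifts-cong L (e ∷ M) eq)

  -- `∑lifts` postpones the choice of a single lift to the end of the recursion; this brings the
  -- choice to the front.
  ∑lifts-∷ : ∀ L M {W} u v t → Invariant W →
    ∑lifts L ((u , v , t) ∷ M) W ≡ ∑₂ (λ s → ∑lifts L M (λ l → W ((u , s) ∷ (v , t · s) ∷ l)))
  ∑lifts-∷ []                 M     u v t inv = refl
  ∑lifts-∷ ((a , b , t′) ∷ L) M {W} u v t inv = sym (begin
    ∑₂ (λ s → B s + N s + O s)
      ≡⟨ ∑₂-+ (λ s → B s + N s) O ⟩
    ∑₂ (λ s → B s + N s) + ∑₂ O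
      ≡⟨ cong₂ _+_ (∑₂-+ B N) one ⟩
    ∑₂ B + ∑₂ N + ∑lifts L ((a , b , t′) ∷ (u , v , t) ∷ M) W
      ≡⟨ cong (_+ ∑lifts L ((a , b , t′) ∷ (u , v , t) ∷ M) W) (cong₂ _+_ both (sym (∑lifts-∷ L M u v t inv))) ⟩
    ∑lifts ((a , b , t′) ∷ L) ((u , v , t) ∷ M) W ∎)
    where
    open ≡-Reasoning
    w : Fin 2 → Weight
    w s l = W ((u , s) ∷ (v , t · s) ∷ l)
    B N O : Fin 2 → ℕ
    B s = ∑lifts L M (cancel a (cancel b (w s)))
    N s = ∑lifts L M (w s)
    O s = ∑lifts L ((a , b , t′) ∷ M) (w s)

    both : ∑₂ B ≡ ∑lifts L ((u , v , t) ∷ M) (cancel a (cancel b W))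
    both = trans
      (∑₂-cong λ s → ∑lifts-cong L M λ l → inv (↭-trans (pair-swap (u , s) (v , t · s) (b , 0F) (b , 1F) _)
        (prep _ (prep _ (pair-swap (u , s) (v , t · s) (a , 0F) (a , 1F) l)))))
      (sym (∑lifts-∷ L M u v t λ p → inv (prep _ (prep _ (prep _ (prep _ p))))))

    one : ∑₂ O ≡ ∑lifts L ((a , b , t′) ∷ (u , v , t) ∷ M) W
    one = begin
      ∑₂ O
        ≡⟨ (∑₂-cong λ s → ∑lifts-∷ L M a b t′ (prepend-invariant (u , s) (v , t · s) inv)) ⟩
      ∑₂ (λ s → ∑₂ λ s′ → ∑lifts L M (λ l → W ((u , s) ∷ (v , t · s) ∷ (a , s′) ∷ (b , t′ · s′) ∷ l)))
        ≡⟨ ∑₂-comm _ ⟩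
      ∑₂ (λ s′ → ∑₂ λ s → ∑lifts L M (λ l → W ((u , s) ∷ (v , t · s) ∷ (a , s′) ∷ (b , t′ · s′) ∷ l)))
        ≡⟨ (∑₂-cong λ s′ → ∑₂-cong λ s → ∑lifts-cong L M λ l → inv (pair-swap (u , s) (v , t · s) (a , s′) (b , t′ · s′) l)) ⟩
      ∑₂ (λ s′ → ∑₂ λ s → ∑lifts L M (λ l → W ((a , s′) ∷ (b , t′ · s′) ∷ (u , s) ∷ (v , t · s) ∷ l)))
        ≡⟨ (∑₂-cong λ s′ → sym (∑lifts-∷ L M u v t (prepend-invariant (a , s′) (b , t′ · s′) inv))) ⟩
      ∑₂ (λ s′ → ∑lifts L ((u , v , t) ∷ M) (λ l → W ((a , s′) ∷ (b , t′ · s′) ∷ l)))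
        ≡⟨ ∑lifts-∷ L ((u , v , t) ∷ M) a b t′ inv ⟨
      ∑lifts L ((a , b , t′) ∷ (u , v , t) ∷ M) W ∎

  -- Sums over the subsets of the lifted edges

  lifts : Edge → List (Half × Half)
  lifts (u , v , t) = ((u , 0F) , (v , t · 0F)) ∷ ((u , 1F) , (v , t · 1F)) ∷ []

  ends : List (Half × Half) → List Half
  ends []            = []
  ends ((x , y) ∷ S) = x ∷ y ∷ ends S

  ∑⊆ : List (Half × Half) → Weight → ℕ
  ∑⊆ []            W = W []
  ∑⊆ ((x , y) ∷ E) W = ∑⊆ E (λ l → W (x ∷ y ∷ l)) + ∑⊆ E W

  ∑⊆-subsets : ∀ E W → ∑⊆ E W ≡ sum (map (W ∘ ends) (subsets E))
  ∑⊆-subsets []            W = sym (+-identityʳ (W []))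
  ∑⊆-subsets ((x , y) ∷ E) W = sym (begin
    sum (map (W ∘ ends) (map ((x , y) ∷_) (subsets E) ++ subsets E))
      ≡⟨ cong sum (map-++ (W ∘ ends) (map ((x , y) ∷_) (subsets E)) (subsets E)) ⟩
    sum (map (W ∘ ends) (map ((x , y) ∷_) (subsets E)) ++ map (W ∘ ends) (subsets E))
      ≡⟨ sum-++ (map (W ∘ ends) (map ((x , y) ∷_) (subsets E))) _ ⟩
    sum (map (W ∘ ends) (map ((x , y) ∷_) (subsets E))) + sum (map (W ∘ ends) (subsets E))
      ≡⟨ cong₂ _+_ (trans (cong sum (sym (map-∘ (subsets E)))) (sym (∑⊆-subsets E _))) (sym (∑⊆-subsets E W)) ⟩
    ∑⊆ E (λ l → W (x ∷ y ∷ l)) + ∑⊆ E W ∎)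
    where open ≡-Reasoning

  ∑⊆-cong : ∀ E {W W′} → (∀ l → W l ≡ W′ l) → ∑⊆ E W ≡ ∑⊆ E W′
  ∑⊆-cong []      eq = eq []
  ∑⊆-cong (_ ∷ E) eq = cong₂ _+_ (∑⊆-cong E λ l → eq _) (∑⊆-cong E eq)

  ∑⊆-↭ : ∀ {E E′ W} → E ↭ E′ → Invariant W → ∑⊆ E W ≡ ∑⊆ E′ W
  ∑⊆-↭ _↭_.refl inv = refl
  ∑⊆-↭ (prep (x , y) p) inv = cong₂ _+_ (∑⊆-↭ p (prepend-invariant x y inv)) (∑⊆-↭ p inv)
  ∑⊆-↭ {E = _ ∷ _ ∷ E} {E′ = _ ∷ _ ∷ E′} {W} (swap (x , y) (x′ , y′) p) inv = trans
    (cong₂ _+_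
      (cong₂ _+_
        (trans (∑⊆-cong E λ l → inv (pair-swap x y x′ y′ l))
          (∑⊆-↭ p (prepend-invariant x y (prepend-invariant x′ y′ inv))))
        (∑⊆-↭ p (prepend-invariant x y inv)))
      (cong₂ _+_ (∑⊆-↭ p (prepend-invariant x′ y′ inv)) (∑⊆-↭ p inv)))
    (interchange (∑⊆ E′ (λ l → W (x′ ∷ y′ ∷ x ∷ y ∷ l))) _ _ _)
  ∑⊆-↭ (_↭_.trans p q) inv = trans (∑⊆-↭ p inv) (∑⊆-↭ q inv)

  -- The four subsets of the two lifts of an edge are grouped into both, none, and the two
  -- singletons.
  ∑⊆-lifts : ∀ L {W} → Invariant W → ∑⊆ (concatMap lifts L) W ≡ ∑lifts L [] W
  ∑⊆-lifts []                    inv = refl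
  ∑⊆-lifts ((u , v , t) ∷ L) {W} inv = begin
    (∑⊆ E (λ l → W (u₀ ∷ v₀ ∷ u₁ ∷ v₁ ∷ l)) + ∑⊆ E (w 0F)) + (∑⊆ E (w 1F) + ∑⊆ E W)
      ≡⟨ rearrange (∑⊆ E (λ l → W (u₀ ∷ v₀ ∷ u₁ ∷ v₁ ∷ l))) _ _ _ ⟩
    ∑⊆ E (λ l → W (u₀ ∷ v₀ ∷ u₁ ∷ v₁ ∷ l)) + ∑⊆ E W + (∑⊆ E (w 0F) + ∑⊆ E (w 1F))
      ≡⟨ cong₂ _+_ (cong₂ _+_ both (∑⊆-lifts L inv)) one ⟩
    ∑lifts ((u , v , t) ∷ L) [] W ∎
    where
    open ≡-Reasoning
    E = concatMap lifts L
    u₀ = u , 0F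
    u₁ = u , 1F
    v₀ = v , t · 0F
    v₁ = v , t · 1F
    w : Fin 2 → Weight
    w s l = W ((u , s) ∷ (v , t · s) ∷ l)

    rearrange : ∀ a b c d → (a + b) + (c + d) ≡ a + d + (b + c)
    rearrange = solve-∀

    -- Together the two lifts have one end at each lift of `u` and of `v`, whatever the type `t`.
    reorder : ∀ t {l} → u₀ ∷ (v , t · 0F) ∷ u₁ ∷ (v , t · 1F) ∷ l ↭ (v , 0F) ∷ (v , 1F) ∷ u₀ ∷ u₁ ∷ l
    reorder parallel {l} = ↭-trans (prep _ (swap _ _ ↭-refl)) (pair-swap _ _ _ _ l)
    reorder crossed  {l} = ↭-trans (prep _ (swap _ _ ↭-refl)) (↭-trans (pair-swap _ _ _ _ l) (swap _ _ ↭-refl))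

    both : ∑⊆ E (λ l → W (u₀ ∷ v₀ ∷ u₁ ∷ v₁ ∷ l)) ≡ ∑lifts L [] (cancel u (cancel v W))
    both = trans (∑⊆-cong E λ l → inv (reorder t))
      (∑⊆-lifts L λ p → inv (prep _ (prep _ (prep _ (prep _ p)))))

    one : ∑⊆ E (w 0F) + ∑⊆ E (w 1F) ≡ ∑lifts L ((u , v , t) ∷ []) W
    one = trans (cong₂ _+_ (∑⊆-lifts L (prepend-invariant u₀ v₀ inv)) (∑⊆-lifts L (prepend-invariant u₁ v₁ inv)))
      (trans (sym (∑₂-def (λ s → ∑lifts L [] (w s)))) (sym (∑lifts-∷ L [] u v t inv)))

  ∑⊆-cross-max : ∀ L {E E′ W} → BalancedWeight W → E ↭ concatMap lifts L → E′ ↭ concatMap lifts (map cross L) →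
    ∑⊆ E W ≤ ∑⊆ E′ W
  ∑⊆-cross-max L {E} {E′} {W} good p p′ = begin
    ∑⊆ E W                                ≡⟨ ∑⊆-↭ p invariant ⟩
    ∑⊆ (concatMap lifts L) W              ≡⟨ ∑⊆-lifts L invariant ⟩
    ∑lifts L [] W                         ≤⟨ ∑lifts-cross-max L [] good ⟩
    ∑lifts (map cross L) [] W             ≡⟨ ∑⊆-lifts (map cross L) invariant ⟨
    ∑⊆ (concatMap lifts (map cross L)) W  ≡⟨ ∑⊆-↭ p′ invariant ⟨
    ∑⊆ E′ W                               ∎
    where
    open ≤-Reasoning
    open BalancedWeight good

  mult-↭ : ∀ u i {l l′} → l ↭ l′ → mult u i l ≡ mult u i l′
  mult-↭ u i _↭_.refl        = refl
  mult-↭ u i (prep x p)      = cong (hit u i x +_) (mult-↭ u i p)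
  mult-↭ u i (swap x y p)    = trans
    (cong (λ n → hit u i x + (hit u i y + n)) (mult-↭ u i p))
    (x∙yz≈y∙xz (hit u i x) (hit u i y) _)
  mult-↭ u i (_↭_.trans p q) = trans (mult-↭ u i p) (mult-↭ u i q)

  hit-indicator : ∀ u i x (eq? : Dec ((u , i) ≡ x)) → hit u i x ≡ indicator eq?
  hit-indicator u 0F (a , 0F) eq? = indicator-cong (cong (_, 0F)) (cong proj₁) (u ≟ a) eq?
  hit-indicator u 0F (a , 1F) eq? = sym (indicator-no (λ ()) eq?)
  hit-indicator u 1F (a , 0F) eq? = sym (indicator-no (λ ()) eq?)
  hit-indicator u 1F (a , 1F) eq? = indicator-cong (cong (_, 1F)) (cong proj₁) (u ≟ a) eq?

-- Vertices and edges of a 2-cover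

both : {A : Set} → A → List (A × Fin 2)
both v = (v , 0F) ∷ (v , 1F) ∷ []

-- `remQuot` sends 2i and 2i + 1 to the pairs over i, so the two lifts of each vertex are listed
-- consecutively.
tabulate-remQuot : ∀ {B : Set} n (g : Fin n × Fin 2 → B) →
  tabulate (g ∘ remQuot {n} 2) ≡ concat (tabulate λ i → g (i , 0F) ∷ g (i , 1F) ∷ [])
tabulate-remQuot zero    g = refl
tabulate-remQuot (suc n) g = cong (λ l → g (zero , 0F) ∷ g (zero , 1F) ∷ l)
  (tabulate-remQuot n (λ (i , j) → g (suc i , j)))

module Cover (G : FiniteGraph) where
  open FiniteGraph G
  open Configurations _≟_

  label : EdgeLifts G → V × V → Edge
  label σ (u , v) = u , v , EdgeLifts.lift σ u v

  module _ (σ : EdgeLifts G) where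
    private
      H = twoCover G σ
      module H = FiniteGraph H

    vertices-twoCover : H.vertices ≡ concatMap both vertices
    vertices-twoCover = begin
      map (g ∘ remQuot {order} 2) (allFin (order * 2))
        ≡⟨ map-tabulate (λ i → i) (g ∘ remQuot {order} 2) ⟩
      tabulate (g ∘ remQuot {order} 2)
        ≡⟨ tabulate-remQuot order g ⟩
      concat (tabulate (both ∘ from))
        ≡⟨ cong concat (map-tabulate (λ i → i) (both ∘ from)) ⟨
      concatMap (both ∘ from) (allFin order)
        ≡⟨ concatMap-map both from (allFin order) ⟨
      concatMap both vertices ∎
      where
      open ≡-Reasoning
      open Inverse finite using (from)
      g : Fin order × Fin 2 → V × Fin 2
      g (i , j) = from i , j

    private
      adjG? : Decidable (λ (e : V × V) → proj₁ e ~ proj₂ e)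
      adjG? e = proj₁ e ~? proj₂ e

      adjH? : Decidable (λ (e : Half × Half) → proj₁ e H.~ proj₂ e)
      adjH? e = proj₁ e H.~? proj₂ e

      liftAll : List (V × V) → List (Half × Half)
      liftAll es = concatMap lifts (map (label σ) es)

    liftAll-++ : ∀ es fs → liftAll (es ++ fs) ≡ liftAll es ++ liftAll fs
    liftAll-++ es fs = trans (cong (concatMap lifts) (map-++ (label σ) es fs))
      (concatMap-++ lifts (map (label σ) es) (map (label σ) fs))

    -- Exactly one lift of `y` is joined to `(x , i)`. In `go` its index is generalised to `j`, so
    -- that a case split shows which candidate the filter keeps.
    keep-lift : ∀ {x y} → x ~ y → ∀ i es →
      filter adjH? (map ((x , i) ,_) (both y) ++ es) ≡ ((x , i) , (y , EdgeLifts.lift σ x y · i)) ∷ filter adjH? es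
    keep-lift {x} {y} x~y i es = go (t · i) (joins-· t i) (¬joins-flip t i)
      where
      t = EdgeLifts.lift σ x y
      go : ∀ j → Joins t i j → ¬ Joins t i (flip j) →
        filter adjH? (map ((x , i) ,_) (both y) ++ es) ≡ ((x , i) , (y , j)) ∷ filter adjH? es
      go 0F J ¬J = trans (filter-accept adjH? (x~y , J)) (cong (_ ∷_) (filter-reject adjH? (¬J ∘ proj₂)))
      go 1F J ¬J = trans (filter-reject adjH? (¬J ∘ proj₂)) (filter-accept adjH? (x~y , J))

    drop-lifts : ∀ {x y} → ¬ x ~ y → ∀ i es →
      filter adjH? (map ((x , i) ,_) (both y) ++ es) ≡ filter adjH? es
    drop-lifts x≁y i es = trans (filter-reject adjH? (x≁y ∘ proj₁)) (filter-reject adjH? (x≁y ∘ proj₁))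

    -- Only a permutation: the cover lists all edges at `(x , 0F)` before those at `(x , 1F)`, while
    -- `liftAll` keeps the two lifts of an edge together.
    edges-at : ∀ x ys →
      filter adjH? (map ((x , 0F) ,_) (concatMap both ys)) ++ filter adjH? (map ((x , 1F) ,_) (concatMap both ys))
      ↭ liftAll (filter adjG? (map (x ,_) ys))
    edges-at x []       = ↭-refl
    edges-at x (y ∷ ys) = go (x ~? y)
      where
      open PermutationReasoning
      row : Fin 2 → List V → List (Half × Half)
      row i ys = map ((x , i) ,_) (concatMap both ys)
      go : Dec (x ~ y) → filter adjH? (row 0F (y ∷ ys)) ++ filter adjH? (row 1F (y ∷ ys))
        ↭ liftAll (filter adjG? (map (x ,_) (y ∷ ys)))
      go (no x≁y) = begin
        filter adjH? (row 0F (y ∷ ys)) ++ filter adjH? (row 1F (y ∷ ys))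
          ≡⟨ cong₂ _++_ (drop-lifts x≁y 0F (row 0F ys)) (drop-lifts x≁y 1F (row 1F ys)) ⟩
        filter adjH? (row 0F ys) ++ filter adjH? (row 1F ys)
          ↭⟨ edges-at x ys ⟩
        liftAll (filter adjG? (map (x ,_) ys))
          ≡⟨ cong liftAll (filter-reject adjG? x≁y) ⟨
        liftAll (filter adjG? (map (x ,_) (y ∷ ys))) ∎
      go (yes x~y) = begin
        filter adjH? (row 0F (y ∷ ys)) ++ filter adjH? (row 1F (y ∷ ys))
          ≡⟨ cong₂ _++_ (keep-lift x~y 0F (row 0F ys)) (keep-lift x~y 1F (row 1F ys)) ⟩
        _ ∷ (filter adjH? (row 0F ys) ++ _ ∷ filter adjH? (row 1F ys))
          ↭⟨ prep _ (shift _ (filter adjH? (row 0F ys)) _) ⟩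
        _ ∷ _ ∷ (filter adjH? (row 0F ys) ++ filter adjH? (row 1F ys))
          ↭⟨ prep _ (prep _ (edges-at x ys)) ⟩
        liftAll ((x , y) ∷ filter adjG? (map (x ,_) ys))
          ≡⟨ cong liftAll (filter-accept adjG? x~y) ⟨
        liftAll (filter adjG? (map (x ,_) (y ∷ ys))) ∎

    edges-among : ∀ xs → filter adjH? (unorderedPairs (concatMap both xs)) ↭ liftAll (filter adjG? (unorderedPairs xs))
    edges-among []       = ↭-refl
    edges-among (x ∷ xs) = begin
      filter adjH? (((x , 0F) , (x , 1F)) ∷ (A₀ ++ (A₁ ++ U)))
        -- The two lifts of `x` are not adjacent, because `G` has no loops.
        ≡⟨ filter-reject adjH? (λ (x~x , _) → ~-irrefl refl x~x) ⟩
      filter adjH? (A₀ ++ (A₁ ++ U))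
        ≡⟨ filter-++ adjH? A₀ (A₁ ++ U) ⟩
      filter adjH? A₀ ++ filter adjH? (A₁ ++ U)
        ≡⟨ cong (filter adjH? A₀ ++_) (filter-++ adjH? A₁ U) ⟩
      filter adjH? A₀ ++ (filter adjH? A₁ ++ filter adjH? U)
        ≡⟨ ++-assoc (filter adjH? A₀) _ _ ⟨
      (filter adjH? A₀ ++ filter adjH? A₁) ++ filter adjH? U
        ↭⟨ ↭-++⁺ (edges-at x xs) (edges-among xs) ⟩
      liftAll (filter adjG? (map (x ,_) xs)) ++ liftAll (filter adjG? (unorderedPairs xs))
        ≡⟨ liftAll-++ (filter adjG? (map (x ,_) xs)) _ ⟨
      liftAll (filter adjG? (map (x ,_) xs) ++ filter adjG? (unorderedPairs xs))
        ≡⟨ cong liftAll (filter-++ adjG? (map (x ,_) xs) (unorderedPairs xs)) ⟨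
      liftAll (filter adjG? (unorderedPairs (x ∷ xs))) ∎
      where
      open PermutationReasoning
      A₀ = map ((x , 0F) ,_) (concatMap both xs)
      A₁ = map ((x , 1F) ,_) (concatMap both xs)
      U  = unorderedPairs (concatMap both xs)

    edges-twoCover : edges H ↭ concatMap lifts (map (label σ) (edges G))
    edges-twoCover = subst (λ vs → filter adjH? (unorderedPairs vs) ↭ liftAll (edges G))
      (sym vertices-twoCover) (edges-among vertices)

    -- `degree` counts edges and `mult` counts ends; these agree when no edge has both ends at one
    -- vertex.
    degree-mult : ∀ {S} → All (λ e → proj₁ e ≢ proj₂ e) S → ∀ u i → degree H S (u , i) ≡ mult u i (ends S)
    degree-mult []                             u i = refl
    degree-mult (_∷_ {x = x , y} {S} x≢y ps) u i = begin
      degree H ((x , y) ∷ S) (u , i)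
        ≡⟨ length-filter-∷ (incident? H (u , i)) (x , y) S ⟩
      indicator (incident? H (u , i) (x , y)) + degree H S (u , i)
        ≡⟨ cong₂ _+_ (indicator-⊎ (λ (p , q) → x≢y (trans (sym p) q)) ((u , i) H.≟ x) ((u , i) H.≟ y)) (degree-mult ps u i) ⟩
      indicator ((u , i) H.≟ x) + indicator ((u , i) H.≟ y) + mult u i (ends S)
        ≡⟨ cong (_+ mult u i (ends S)) (cong₂ _+_ (hit-indicator u i x ((u , i) H.≟ x)) (hit-indicator u i y ((u , i) H.≟ y))) ⟨
      hit u i x + hit u i y + mult u i (ends S)
        ≡⟨ +-assoc (hit u i x) _ _ ⟩
      hit u i x + (hit u i y + mult u i (ends S)) ∎
      where open ≡-Reasoning

  -- Counting subgraphs with prescribed degrees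

  Realises : (V → ℤ) → List Half → Set
  Realises r l = ∀ (x : Half) → pos (mult (proj₁ x) (proj₂ x) l) ≡ r (proj₁ x)

  -- All 2-covers share the vertex set of `G ×K₂`, so one decision procedure, and hence one weight,
  -- serves them all.
  realises? : ∀ r l → Dec (Realises r l)
  realises? r l = FiniteGraph.all? (G ×K₂) (λ x → pos (mult (proj₁ x) (proj₂ x) l) ℤ.≟ r (proj₁ x))

  weight : (V → ℤ) → Weight
  weight r l = indicator (realises? r l)

  -- The induced vector has the same value at both lifts of a vertex, which forces equal
  -- multiplicities.
  weight-balanced : ∀ r → BalancedWeight (weight r)
  weight-balanced r = record
    { invariant = λ p → indicator-cong
        (λ R (u , i) → trans (cong pos (sym (mult-↭ u i p))) (R (u , i)))
        (λ R (u , i) → trans (cong pos (mult-↭ u i p)) (R (u , i))) _ _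
    ; balanced = λ l ≢0 u → let R = indicator-true (realises? r l) ≢0 in
        ℤ.+-injective (trans (R (u , 0F)) (sym (R (u , 1F))))
    }

  h-twoCover : ∀ σ r → h (twoCover G σ) (induced r) ≡ ∑⊆ (edges (twoCover G σ)) (weight r)
  h-twoCover σ r = begin
    h H (induced r)
      ≡⟨ length-filter (hasDegrees? H (induced r)) (subsets (edges H)) ⟩
    sum (map (indicator ∘ hasDegrees? H (induced r)) (subsets (edges H)))
      ≡⟨ cong sum (map-cong-local (All.map same (All-subsets proper))) ⟩
    sum (map (weight r ∘ ends) (subsets (edges H)))
      ≡⟨ ∑⊆-subsets (edges H) (weight r) ⟨
    ∑⊆ (edges H) (weight r) ∎
    where
    open ≡-Reasoning
    H = twoCover G σ
    module H = FiniteGraph H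
    proper : All (λ e → proj₁ e ≢ proj₂ e) (edges H)
    proper = All.map (λ x~y x≡y → H.~-irrefl x≡y x~y)
      (all-filter (λ e → proj₁ e H.~? proj₂ e) (unorderedPairs H.vertices))
    same : ∀ {S} → All (λ e → proj₁ e ≢ proj₂ e) S → indicator (hasDegrees? H (induced r) S) ≡ weight r (ends S)
    same ps = indicator-cong
      (λ D (u , i) → trans (cong pos (sym (degree-mult σ ps u i))) (D (u , i)))
      (λ R (u , i) → trans (cong pos (degree-mult σ ps u i)) (R (u , i))) _ _

theorem1p8 : (G : FiniteGraph) (r : FiniteGraph.V G → ℤ) (σ : EdgeLifts G) →
    h (G ×K₂) (induced r) ≥ h (twoCover G σ) (induced r)
theorem1p8 G r σ = subst₂ _≤_ (sym (h-twoCover σ r)) (sym (h-twoCover (allCrossed G) r))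
  (∑⊆-cross-max (map (label σ) (edges G)) (weight-balanced r)
    (edges-twoCover σ)
    -- By computation, `label (allCrossed G)` is `cross` after `label σ`.
    (↭-trans (edges-twoCover (allCrossed G)) (↭-reflexive (cong (concatMap lifts) (map-∘ (edges G))))))
  where
  open Cover G
  open Configurations (FiniteGraph._≟_ G)
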